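{- The middle levels conjecture holds for $k=18$: the middle levels graph $M_{37}$, i.e. the subgraph of the $37$-dimensional hypercube $Q_{37}$ induced by the vertices whose labels have exactly $18$ or exactly $19$ ones, has a Hamiltonian cycle.
   Context: For a positive integer $n$, $Q_n$ denotes the $n$-dimensional hypercube: the graph whose $2^n$ vertices are labeled by the $n$-bit binary strings, two vertices being adjacent iff their strings differ in exactly one bit. The $i$-th level of $Q_n$ is the set of vertices labeled by strings with exactly $i$ ones. For a positive integer $k$, the middle levels graph $M_{2k+1}$ is the subgraph of $Q_{2k+1}$ induced by levels $k$ and $k+1$. The middle levels conjecture asserts that $M_{2k+1}$ has a Hamiltonian cycle for every $k$. -}

module Defs where

open import Data.Bool.Base using (Bool; true)
open import Data.Bool.Properties using (_≟_)
open import Data.List.Base using (List; []; _∷_; _∷ʳ_; length)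
open import Data.List.Membership.Propositional using (_∈_)
open import Data.List.Relation.Unary.Linked using (Linked)
open import Data.List.Relation.Unary.Unique.Propositional using (Unique)
open import Data.Nat.Base using (ℕ; _+_; _*_; _≤_)
open import Data.Product using (∃; ∃!; _×_; _,_)
open import Data.Refinement.Base using (Refinement; value)
open import Data.Sum.Base using (_⊎_)
open import Data.Vec.Base using (Vec; count; lookup)
open import Function.Base using (_∘_)
open import Relation.Binary.Core using (Rel)
open import Relation.Binary.Definitions using (Symmetric; Irreflexive)
open import Relation.Binary.PropositionalEquality using (_≡_; _≢_; refl; ≢-sym)
open import Relation.Unary using (Pred)
open import Level using (0ℓ)

record Graph : Set₁ where
  field
    Vertex : Set
    Adj    : Rel Vertex 0ℓ
    sym    : Symmetric Adj
    irrefl : Irreflexive _≡_ Adj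

open Graph using (Vertex; Adj)

-- The membership proof carried by a vertex of the induced subgraph is
-- irrelevant, so its vertices are exactly the vertices of G satisfying P,
-- each occurring once.
induced : (G : Graph) → Pred (Vertex G) 0ℓ → Graph
induced G P = record
  { Vertex = Refinement (Vertex G) P
  ; Adj    = λ u v → Adj G (value u) (value v)
  ; sym    = Graph.sym G
  ; irrefl = λ { refl → Graph.irrefl G refl }
  }

Hypercube : ℕ → Graph
Hypercube n = record
  { Vertex = Vec Bool n
  ; Adj    = λ u v → ∃! _≡_ λ i → lookup u i ≢ lookup v i
  ; sym    = λ { (i , u≢v , unique) → i , ≢-sym u≢v , unique ∘ ≢-sym }
  ; irrefl = λ { refl (_ , u≢u , _) → u≢u refl }
  }

ones : ∀ {n} → Vec Bool n → ℕ
ones = count (_≟ true)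

Level : ∀ {n} → ℕ → Pred (Vertex (Hypercube n)) 0ℓ
Level i v = ones v ≡ i

MiddleLevels : ℕ → Graph
MiddleLevels k =
  induced (Hypercube (2 * k + 1)) (λ v → Level k v ⊎ Level (k + 1) v)

closeUp : ∀ {A : Set} → List A → List A
closeUp []       = []
closeUp (v ∷ vs) = (v ∷ vs) ∷ʳ v

-- A cycle is listed by its vertices in order, without repeating the first
-- one at the end. The length bound excludes a single edge walked back and
-- forth, which is closed and has distinct vertices but is not a cycle.
record IsCycle (G : Graph) (vs : List (Vertex G)) : Set where
  field
    length≥3 : 3 ≤ length vs
    distinct : Unique vs
    adjacent : Linked (Adj G) (closeUp vs)

HasHamiltonianCycle : Graph → Set
HasHamiltonianCycle G = ∃ λ vs → IsCycle G vs × (∀ v → v ∈ vs)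

{-# OPTIONS --safe #-}
-- The vertices of the graph are the words with k or k+1 ones among 2k+1
-- letters. For every Dyck word u of length 2k there is a path through 4k+2 of
-- them from 1u via 0u to u0, and these paths partition the vertices. As u0 is
-- adjacent to 1 rotate(u), where rotate(1u0v) = u1v0 rotates the plane tree of
-- a Dyck word, they close up to one cycle for each orbit of rotate. For a pair
-- x = 110u0v, y = 101u0v a 6-cycle exchanges the ends of the paths of x and y;
-- these pairs are disjoint, so the exchanges are independent. Exchanging a pair
-- that lies on two cycles merges them. Rotations and exchanges connect all Dyck
-- words of length 2k with (10)^k, so that greedy merging leaves a single cycle.
module Submission where

open import Defs
open import Data.Bool.Base using (Bool; true; false; not; _xor_)
open import Data.Empty using (⊥-elim)
open import Data.Fin.Base using (zero; suc)
open import Data.Irrelevant using () renaming ([_] to irr)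
open import Data.List.Base
  using (List; []; _∷_; _∷ʳ_; _++_; map; concatMap; length; foldr; cartesianProductWith)
import Data.List.Membership.DecPropositional as DecMembership
open import Data.List.Membership.Propositional using (_∈_; find; lose)
open import Data.List.Membership.Propositional.Properties
  using (∈-map⁺; ∈-map⁻; ∈-++⁺ˡ; ∈-++⁺ʳ; ∈-++⁻; ∈-concatMap⁺; ∈-concatMap⁻; ∈-cartesianProductWith⁺)
open import Data.List.Properties using (++-assoc; ++-identityʳ; length-++; map-++; length-map)
open import Data.List.Relation.Binary.Permutation.Propositional using (_↭_; ↭-refl; ↭-sym; ↭⇒↭ₛ)
open import Data.List.Relation.Binary.Permutation.Propositional.Properties using (∈-resp-↭; ++⁺ʳ; ↭-reverse)
open import Data.List.Relation.Binary.Permutation.Setoid.Properties using (Unique-resp-↭)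
open import Data.List.Relation.Unary.All as All using (All; []; _∷_)
open import Data.List.Relation.Unary.All.Properties using (¬Any⇒All¬)
open import Data.List.Relation.Unary.AllPairs using ([]; _∷_)
open import Data.List.Relation.Unary.Any using (Any; here; there)
open import Data.List.Relation.Unary.Linked as Linked using (Linked; [-]; _∷_)
import Data.List.Relation.Unary.Linked.Properties as Linked
open import Data.List.Relation.Unary.Unique.Propositional using (Unique)
import Data.List.Relation.Unary.Unique.Propositional.Properties as Unique
open import Data.Nat.Base using (ℕ; zero; suc; _+_; _*_; _≤_; z≤n; s≤s)
open import Data.Nat.Properties as ℕ
  using (+-assoc; +-comm; +-suc; +-cancelˡ-≡; *-cancelˡ-≡; suc-injective; ≤-trans; ≤-reflexive; m≤m+n; m≤n+m)
open import Data.Nat.Tactic.RingSolver using (solve-∀)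
open import Data.Product using (∃; _×_; _,_; proj₁; proj₂)
open import Data.Refinement.Base using (value) renaming (_,_ to _⊢_)
open import Data.Sum.Base as Sum using (_⊎_; inj₁; inj₂; [_,_])
open import Data.Vec.Base as Vec using (Vec; []; _∷_; toList; fromList; lookup)
import Data.Vec.Properties as Vec
open import Function.Base using (_∘_; id)
open import Level using (0ℓ)
open import Relation.Binary.Construct.Closure.Equivalence using (EqClosure; fold)
open import Relation.Binary.Construct.Closure.ReflexiveTransitive as Star using (Star; ε; _◅_; _◅◅_)
open import Relation.Binary.Construct.Closure.Symmetric using (fwd; bwd)
open import Relation.Binary.Core using (Rel)
open import Relation.Binary.Definitions using (DecidableEquality; Symmetric)
open import Relation.Binary.PropositionalEquality
  using (_≡_; _≢_; refl; sym; trans; cong; cong₂; subst; subst₂; setoid; ≢-sym; module ≡-Reasoning)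
open import Relation.Binary.Structures using (IsEquivalence)
open import Relation.Nullary using (¬_; Dec; yes; no; does)
open import Relation.Nullary.Decidable using (recompute; _⊎-dec_)

-- Orbits and cycles of a function

-- The list omits the starting point and includes the end, so that paths are joined by plain `_++_`.
data Path {X : Set} (R : Rel X 0ℓ) : X → List X → X → Set where
  []  : ∀ {a} → Path R a [] a
  _∷_ : ∀ {a b c xs} → R a b → Path R b xs c → Path R a (b ∷ xs) c

path-++ : ∀ {X} {R : Rel X 0ℓ} {a b c xs ys} →
          Path R a xs b → Path R b ys c → Path R a (xs ++ ys) c
path-++ []      q = q
path-++ (r ∷ p) q = r ∷ path-++ p q

module _ {X : Set} (f : X → X) where

  Next : Rel X 0ℓ
  Next a b = f a ≡ b

  Orbit : Rel X 0ℓ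
  Orbit = Star Next

  -- Plays the part of "permutation with finite cycles" on the infinite type of trees.
  Periodic : Set
  Periodic = ∀ z → Orbit (f z) z

  -- A step is undone by going the rest of the way round its cycle.
  orbit-sym : Periodic → Symmetric Orbit
  orbit-sym per ε          = ε
  orbit-sym per (refl ◅ p) = orbit-sym per p ◅◅ per _

  path⇒orbit : ∀ {a b z xs} → Path Next a xs b → z ∈ a ∷ xs → Orbit a z
  path⇒orbit p       (here refl) = ε
  path⇒orbit (r ∷ p) (there z∈)  = r ◅ path⇒orbit p z∈

  end∈path : ∀ {a b xs} → Path Next a xs b → b ∈ a ∷ xs
  end∈path []      = here refl
  end∈path (_ ∷ p) = there (end∈path p)

  next∈path : ∀ {a b z xs} → Path Next a xs b → z ∈ a ∷ xs → z ≡ b ⊎ f z ∈ xs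
  next∈path []         (here z≡b)  = inj₁ z≡b
  next∈path (refl ∷ p) (here refl) = inj₂ (here refl)
  next∈path (_ ∷ p)    (there z∈)  with next∈path p z∈
  ... | inj₁ z≡b = inj₁ z≡b
  ... | inj₂ fz∈ = inj₂ (there fz∈)

  -- Every listed point but `a` has its successor further on in the list, and the successor of `a`
  -- is the head. So the list is the whole cycle, which makes orbits decidable.
  cycle-closed : ∀ {a xs z w} → Path Next (f a) xs a → z ∈ f a ∷ xs → Orbit z w → w ∈ f a ∷ xs
  cycle-closed p z∈ ε = z∈
  cycle-closed p z∈ (refl ◅ q) with next∈path p z∈
  ... | inj₁ refl = cycle-closed p (here refl) q
  ... | inj₂ fz∈  = cycle-closed p (there fz∈) q

  module _ (_≟_ : DecidableEquality X) where
    open DecMembership _≟_ using (_∈?_)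

    suffix : ∀ {a b c xs} → Path Next a xs b → Unique (a ∷ xs) → c ∈ a ∷ xs →
             ∃ λ ys → Path Next c ys b × Unique (c ∷ ys)
    suffix p       u       (here refl) = _ , p , u
    suffix (_ ∷ p) (_ ∷ u) (there c∈)  = suffix p u c∈

    -- Loop erasure: whenever the new starting point recurs later, everything before its recurrence
    -- is cut off.
    orbit⇒path : ∀ {a b} → Orbit a b → ∃ λ xs → Path Next a xs b × Unique (a ∷ xs)
    orbit⇒path ε = [] , [] , [] ∷ []
    orbit⇒path {a} (r ◅ o) with orbit⇒path o
    ... | xs , p , u with a ∈? (_ ∷ xs)
    ...   | yes a∈ = suffix p u a∈
    ...   | no  a∉ = _ , r ∷ p , ¬Any⇒All¬ _ a∉ ∷ u

    orbit? : Periodic → ∀ a b → Dec (Orbit a b)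
    orbit? per a b with orbit⇒path (per a)
    ... | xs , p , _ with b ∈? (f a ∷ xs)
    ...   | yes b∈ = yes (refl ◅ path⇒orbit p b∈)
    ...   | no  b∉ = no (b∉ ∘ cycle-closed p (end∈path p))

-- Merging two cycles of a permutation

module _ {X : Set} (_≟_ : DecidableEquality X) {f g : X → X} where

  -- The walk to `p` stays on the `f`-cycle of `p`, so it never meets `q`, and before it reaches `p`
  -- both maps agree.
  follow : ∀ {p q z} → (∀ z → z ≢ p → z ≢ q → g z ≡ f z) → ¬ Orbit f p q →
           Orbit f p z → Orbit f z p → Orbit g z p
  follow g≗f p↛q pz ε = ε
  follow {p} {q} {z} g≗f p↛q pz (refl ◅ zp) with z ≟ p
  ... | yes refl = ε
  ... | no z≢p   = g≗f z z≢p (λ { refl → p↛q pz }) ◅ follow g≗f p↛q (pz ◅◅ refl ◅ ε) zp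

  -- Exchanging the successors of two points on different cycles of f
  -- concatenates the two cycles.
  module Merge (per : Periodic f) {x y : X} (x↛y : ¬ Orbit f x y)
               (gx : g x ≡ f y) (gy : g y ≡ f x)
               (g≗f : ∀ z → z ≢ x → z ≢ y → g z ≡ f z) where

    private
      fx⇝x : Orbit g (f x) x
      fx⇝x = follow g≗f x↛y (refl ◅ ε) (per x)

      fy⇝y : Orbit g (f y) y
      fy⇝y = follow (λ z z≢y z≢x → g≗f z z≢x z≢y) (x↛y ∘ orbit-sym f per) (refl ◅ ε) (per y)

    merged : Orbit g x y
    merged = gx ◅ fy⇝y

    -- An `f`-step out of `x` or `y` becomes a detour along the merged cycle.
    coarser : ∀ {a b} → Orbit f a b → Orbit g a b
    coarser ε = ε
    coarser {a} (refl ◅ o) with a ≟ x | a ≟ y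
    ... | yes refl | _        = merged ◅◅ gy ◅ coarser o
    ... | no _     | yes refl = gy ◅ fx⇝x ◅◅ gx ◅ coarser o
    ... | no a≢x   | no a≢y   = g≗f a a≢x a≢y ◅ coarser o

    periodic : Periodic g
    periodic z with z ≟ x | z ≟ y
    ... | yes refl | _        = subst (λ w → Orbit g w x) (sym gx) (fy⇝y ◅◅ gy ◅ fx⇝x)
    ... | no _     | yes refl = subst (λ w → Orbit g w y) (sym gy) (fx⇝x ◅◅ merged)
    ... | no z≢x   | no z≢y   = subst (λ w → Orbit g w z) (sym (g≗f z z≢x z≢y)) (coarser (per z))

-- Dyck words as trees, and their rotation

-- A binary tree encodes a Dyck word: node u v stands for 1 u 0 v.
data Tree : Set where
  leaf : Tree
  node : Tree → Tree → Tree

_≟_ : DecidableEquality Tree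
leaf     ≟ leaf     = yes refl
leaf     ≟ node _ _ = no λ ()
node _ _ ≟ leaf     = no λ ()
node a b ≟ node c d with a ≟ c | b ≟ d
... | yes refl | yes refl = yes refl
... | yes _    | no b≢d   = no λ { refl → b≢d refl }
... | no a≢c   | _        = no λ { refl → a≢c refl }

size : Tree → ℕ
size leaf       = 0
size (node u v) = suc (size u + size v)

-- Bounding height instead of size makes the recursion simple; all trees of size at most `n` are
-- included.
trees : ℕ → List Tree
trees zero    = leaf ∷ []
trees (suc n) = leaf ∷ cartesianProductWith node (trees n) (trees n)

∈-trees : ∀ {n} t → size t ≤ n → t ∈ trees n
∈-trees {zero}  leaf       _ = here refl
∈-trees {suc n} leaf       _ = here refl
∈-trees {suc n} (node u v) (s≤s u+v≤n) = there (∈-cartesianProductWith⁺ node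
  (∈-trees u (≤-trans (m≤m+n _ _) u+v≤n)) (∈-trees v (≤-trans (m≤n+m _ (size u)) u+v≤n)))

infixr 5 _⊕_
-- Concatenation of the encoded Dyck words.
_⊕_ : Tree → Tree → Tree
leaf     ⊕ w = w
node u v ⊕ w = node u (v ⊕ w)

⊕-identityʳ : ∀ u → u ⊕ leaf ≡ u
⊕-identityʳ leaf       = refl
⊕-identityʳ (node u v) = cong (node u) (⊕-identityʳ v)

⊕-assoc : ∀ u v w → (u ⊕ v) ⊕ w ≡ u ⊕ (v ⊕ w)
⊕-assoc leaf       v w = refl
⊕-assoc (node a b) v w = cong (node a) (⊕-assoc b v w)

size-⊕ : ∀ u v → size (u ⊕ v) ≡ size u + size v
size-⊕ leaf       v = refl
size-⊕ (node a b) v = cong suc (trans (cong (size a +_) (size-⊕ b v)) (sym (+-assoc (size a) (size b) (size v))))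

rotate : Tree → Tree
rotate leaf       = leaf
rotate (node u v) = u ⊕ node v leaf

size-rotate : ∀ t → size (rotate t) ≡ size t
size-rotate leaf       = refl
size-rotate (node u v) = trans (size-⊕ u (node v leaf))
  (trans (+-suc (size u) (size v + 0)) (cong (λ n → suc (size u + n)) (+-comm (size v) 0)))

-- For u = 1a0b: 1a0bw rotates to a1bw0, by induction on a this reaches 1bw0a, which rotates to
-- bw1a0, and by induction on b this reaches w1a0b.
rotate-⊕ : ∀ u w → Orbit rotate (u ⊕ w) (w ⊕ u)
rotate-⊕ leaf       w = subst (Orbit rotate w) (sym (⊕-identityʳ w)) ε
rotate-⊕ (node a b) w =
  refl ◅ rotate-⊕ a (node (b ⊕ w) leaf) ◅◅
  refl ◅ subst₂ (Orbit rotate) (sym (⊕-assoc b w _)) (⊕-assoc w _ b) (rotate-⊕ b (w ⊕ node a leaf))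

-- From u1v0 via 1v0u and v1u0 back to 1u0v.
rotate-periodic : Periodic rotate
rotate-periodic leaf       = ε
rotate-periodic (node u v) = rotate-⊕ u (node v leaf) ◅◅ refl ◅ rotate-⊕ v (node u leaf)

-- Rotations and flips connect all Dyck words of a given length

-- 110u0v ↔ 101u0v
flip : Tree → Tree
flip leaf                         = leaf
flip (node leaf leaf)             = node leaf leaf
flip (node leaf (node u v))       = node (node leaf u) v
flip (node (node leaf u) v)       = node leaf (node u v)
flip t@(node (node (node _ _) _) _) = t

flip-involutive : ∀ t → flip (flip t) ≡ t
flip-involutive leaf                         = refl
flip-involutive (node leaf leaf)             = refl
flip-involutive (node leaf (node u v))       = refl
flip-involutive (node (node leaf u) v)       = refl
flip-involutive (node (node (node _ _) _) _) = refl

size-flip : ∀ t → size (flip t) ≡ size t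
size-flip leaf                         = refl
size-flip (node leaf leaf)             = refl
size-flip (node leaf (node u v))       = refl
size-flip (node (node leaf u) v)       = refl
size-flip (node (node (node _ _) _) _) = refl

data Step : Rel Tree 0ℓ where
  rotation : ∀ t → Step t (rotate t)
  flipping : ∀ t → Step t (flip t)

infix 4 _≈_
_≈_ : Rel Tree 0ℓ
_≈_ = EqClosure Step

⊕-comm-≈ : ∀ u w → u ⊕ w ≈ w ⊕ u
⊕-comm-≈ u w = Star.map (λ { refl → fwd (rotation _) }) (rotate-⊕ u w)

comb : ℕ → Tree
comb zero    = leaf
comb (suc n) = node leaf (comb n)

comb-+ : ∀ m n → comb (m + n) ≡ comb m ⊕ comb n
comb-+ zero    n = refl
comb-+ (suc m) n = cong (node leaf) (comb-+ m n)

-- A flip frees one 10 from inside the first block. Flips act only at the front, so this 10 is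
-- parked at the end while the shorter block is flattened, and is then brought back.
flatten : ∀ j w → node (comb j) w ≈ node leaf (comb j ⊕ w)
flatten zero    w = ε
flatten (suc j) w =
  fwd (flipping _) ◅
  ⊕-comm-≈ (node leaf leaf) (node (comb j) w) ◅◅
  flatten j (w ⊕ node leaf leaf) ◅◅
  subst (_≈ node leaf (comb (suc j) ⊕ w)) (cong (node leaf) (⊕-assoc (comb j) w (node leaf leaf)))
    (⊕-comm-≈ (comb (suc j) ⊕ w) (node leaf leaf))

-- The context w allows parts to be parked behind the one being treated. With w′ = (10)^|b| w, the
-- chain is 1a0bw, bw1a0, w′1a0, 1a0w′, a1w′0, (10)^|a| 1w′0, 1(10)^|a| 0w′, and `flatten` finishes.
≈-comb-⊕ : ∀ u w → u ⊕ w ≈ comb (size u) ⊕ w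
≈-comb-⊕ leaf       w = ε
≈-comb-⊕ (node a b) w =
  subst (node a leaf ⊕ (b ⊕ w) ≈_) (⊕-assoc b w _) (⊕-comm-≈ (node a leaf) (b ⊕ w)) ◅◅
  ≈-comb-⊕ b (w ⊕ node a leaf) ◅◅
  subst (_≈ node a w′) (⊕-assoc (comb (size b)) w _) (⊕-comm-≈ w′ (node a leaf)) ◅◅
  fwd (rotation _) ◅
  ≈-comb-⊕ a (node w′ leaf) ◅◅
  bwd (rotation _) ◅
  subst (node (comb (size a)) w′ ≈_) (cong (node leaf) (sym comb-assoc)) (flatten (size a) w′)
  where
  w′ : Tree
  w′ = comb (size b) ⊕ w

  comb-assoc : comb (size a + size b) ⊕ w ≡ comb (size a) ⊕ (comb (size b) ⊕ w)
  comb-assoc = trans (cong (_⊕ w) (comb-+ (size a) (size b))) (⊕-assoc (comb (size a)) _ w)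

≈-comb : ∀ t → t ≈ comb (size t)
≈-comb t = subst₂ _≈_ (⊕-identityʳ t) (⊕-identityʳ _) (≈-comb-⊕ t leaf)

-- Choosing pairs to exchange, and greedy merging

-- A name for the unordered pair {t, flip t}: a Choice, tested at keys only,
-- is a set of such pairs.
key : Tree → Tree
key t@leaf                         = t
key t@(node leaf leaf)             = t
key t@(node leaf (node u v))       = flip t
key t@(node (node leaf u) v)       = t
key t@(node (node (node _ _) _) _) = t

key-flip : ∀ t → key (flip t) ≡ key t
key-flip leaf                         = refl
key-flip (node leaf leaf)             = refl
key-flip (node leaf (node u v))       = refl
key-flip (node (node leaf u) v)       = refl
key-flip (node (node (node _ _) _) _) = refl

key-cases : ∀ t → key t ≡ t ⊎ key t ≡ flip t
key-cases leaf                         = inj₁ refl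
key-cases (node leaf leaf)             = inj₁ refl
key-cases (node leaf (node u v))       = inj₂ refl
key-cases (node (node leaf u) v)       = inj₁ refl
key-cases (node (node (node _ _) _) _) = inj₁ refl

key-injective : ∀ s t → key s ≡ key t → s ≡ t ⊎ s ≡ flip t
key-injective s t eq with key-cases s | key-cases t
... | inj₁ p | inj₁ q = inj₁ (trans (sym p) (trans eq q))
... | inj₁ p | inj₂ q = inj₂ (trans (sym p) (trans eq q))
... | inj₂ p | inj₁ q = inj₂ (trans (sym (flip-involutive s)) (cong flip (trans (sym p) (trans eq q))))
... | inj₂ p | inj₂ q = inj₁ (trans (sym (flip-involutive s))
  (trans (cong flip (trans (sym p) (trans eq q))) (flip-involutive t)))

move : Bool → Tree → Tree
move false t = t
move true  t = flip t

move-involutive : ∀ b t → move b (move b t) ≡ t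
move-involutive false t = refl
move-involutive true  t = flip-involutive t

move-not : ∀ b t → move (not b) t ≡ move b (flip t)
move-not false t = refl
move-not true  t = sym (flip-involutive t)

key-move : ∀ b t → key (move b t) ≡ key t
key-move false t = refl
key-move true  t = key-flip t

size-move : ∀ b t → size (move b t) ≡ size t
size-move false t = refl
size-move true  t = size-flip t

Choice : Set
Choice = Tree → Bool

swap : Choice → Tree → Tree
swap S t = move (S (key t)) t

swap-involutive : ∀ S t → swap S (swap S t) ≡ t
swap-involutive S t = begin
  move (S (key (swap S t))) (swap S t)  ≡⟨ cong (λ k → move (S k) (swap S t)) (key-move (S (key t)) t) ⟩
  move (S (key t)) (swap S t)           ≡⟨ move-involutive (S (key t)) t ⟩
  t                                     ∎
  where open ≡-Reasoning

-- With the chosen pairs exchanged, the path that starts at 1t ends at the word `swap S t` followed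
-- by 0, which is adjacent to the start of the path of `succ S t`.
succ : Choice → Tree → Tree
succ S t = rotate (swap S t)

size-succ : ∀ S t → size (succ S t) ≡ size t
size-succ S t = trans (size-rotate (swap S t)) (size-move (S (key t)) t)

size-orbit : ∀ S {s t} → Orbit (succ S) s t → size s ≡ size t
size-orbit S ε            = refl
size-orbit S (refl ◅ o) = trans (sym (size-succ S _)) (size-orbit S o)

toggle : Tree → Choice → Choice
toggle x S t = does (t ≟ key x) xor S t

swap-toggle-≡ : ∀ S x z → key z ≡ key x → swap (toggle x S) z ≡ swap S (flip z)
swap-toggle-≡ S x z eq with key z ≟ key x
... | yes _  = trans (move-not (S (key z)) z) (cong (λ k → move (S k) (flip z)) (sym (key-flip z)))
... | no neq = ⊥-elim (neq eq)

swap-toggle-≢ : ∀ S x z → key z ≢ key x → swap (toggle x S) z ≡ swap S z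
swap-toggle-≢ S x z neq with key z ≟ key x
... | yes eq = ⊥-elim (neq eq)
... | no _   = refl

-- Toggling one key exchanges the successors of `x` and `flip x` and changes no other, which is the
-- situation of `Merge`.
module Toggle (S : Choice) (per : Periodic (succ S)) {x : Tree} (x↛ : ¬ Orbit (succ S) x (flip x)) =
  Merge _≟_ {g = succ (toggle x S)} per x↛
    (cong rotate (swap-toggle-≡ S x x refl))
    (trans (cong rotate (swap-toggle-≡ S x (flip x) (key-flip x)))
           (cong (succ S) (flip-involutive x)))
    (λ z z≢x z≢fx → cong rotate (swap-toggle-≢ S x z ([ z≢x , z≢fx ] ∘ key-injective z x)))

-- A pair is toggled whenever its members lie on different cycles. Cycles are
-- only ever merged, so in the end every pair lies on one cycle.
joinPairs : ∀ xs S → Periodic (succ S) → ∃ λ S′ → Periodic (succ S′) ×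
            (∀ {a b} → Orbit (succ S) a b → Orbit (succ S′) a b) ×
            (∀ {x} → x ∈ xs → Orbit (succ S′) x (flip x))
joinPairs []       S per = S , per , id , λ ()
joinPairs (x ∷ xs) S per with orbit? (succ S) _≟_ per x (flip x)
... | yes o =
  let S′ , per′ , mono , joined = joinPairs xs S per
  in  S′ , per′ , mono , λ { (here refl) → mono o ; (there x∈) → joined x∈ }
... | no x↛ =
  let S′ , per′ , mono , joined = joinPairs xs (toggle x S) (Toggle.periodic S per x↛)
  in  S′ , per′ , mono ∘ Toggle.coarser S per x↛ ,
      λ { (here refl) → mono (Toggle.merged S per x↛) ; (there x∈) → joined x∈ }

record SingleCycle (n : ℕ) : Set where
  field
    choice   : Choice
    start    : Tree
    others   : List Tree
    path     : Path (Next (succ choice)) (succ choice start) others start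
    unique   : Unique (succ choice start ∷ others)
    complete : ∀ t → size t ≡ n → t ∈ succ choice start ∷ others
    sized    : ∀ {t} → t ∈ succ choice start ∷ others → size t ≡ n

size-comb : ∀ n → size (comb n) ≡ n
size-comb zero    = refl
size-comb (suc n) = cong suc (size-comb n)

singleCycle : ∀ n → SingleCycle n
singleCycle n
  -- For the empty choice, `succ` is `rotate` itself.
  with S , per , mono , joined ← joinPairs (trees n) (λ _ → false) rotate-periodic
  with xs , p , u ← orbit⇒path (succ S) _≟_ (per (comb n)) = record
  { choice   = S
  ; start    = comb n
  ; others   = xs
  ; path     = p
  ; unique   = u
  ; complete = λ t |t|≡n → cycle-closed (succ S) p (end∈path (succ S) p)
      (orbit-sym (succ S) per
        (subst (λ m → Orbit (succ S) t (comb m)) |t|≡n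
          (proj₂ (fold isEquivalence step (≈-comb t)) |t|≡n)))
  ; sized    = λ t∈ → trans (sym (size-orbit S (path⇒orbit (succ S) p t∈)))
                        (trans (size-succ S (comb n)) (size-comb n))
  }
  where
  -- Only pairs in `trees n` have been joined, so the size condition has to travel along the chain
  -- of steps from `t` to `comb n`.
  Joined : Rel Tree 0ℓ
  Joined s t = size s ≡ size t × (size s ≡ n → Orbit (succ S) s t)

  isEquivalence : IsEquivalence Joined
  isEquivalence = record
    { refl  = refl , λ _ → ε
    ; sym   = λ (|s|≡|t| , o) → sym |s|≡|t| ,
                λ |t|≡n → orbit-sym (succ S) per (o (trans |s|≡|t| |t|≡n))
    ; trans = λ (|s|≡|t| , o) (|t|≡|r| , o′) → trans |s|≡|t| |t|≡|r| ,
                λ |s|≡n → o |s|≡n ◅◅ o′ (trans (sym |s|≡|t|) |s|≡n)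
    }

  step : ∀ {s t} → Step s t → Joined s t
  step (rotation t) = sym (size-rotate t) , λ _ → mono (refl ◅ ε)
  step (flipping t) = sym (size-flip t) , λ |t|≡n → joined (∈-trees t (≤-reflexive |t|≡n))

-- Words, and their partition into paths

word : Tree → List Bool
word leaf       = []
word (node u v) = true ∷ word u ++ false ∷ word v

word-⊕ : ∀ u v → word (u ⊕ v) ≡ word u ++ word v
word-⊕ leaf       v = refl
word-⊕ (node a b) v = cong (true ∷_) (trans (cong (λ w → word a ++ false ∷ w) (word-⊕ b v))
  (sym (++-assoc (word a) (false ∷ word b) (word v))))

-- The words with one more or one fewer 1 than 0 (Odd), and the words with
-- as many 1s as 0s or two more (Even), parsed uniquely:
-- 1u, 1u0t, 0b, and u, t1v, with u, v Dyck words.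
data Odd  : Set
data Even : Set

data Odd where
  one : Tree → Odd
  ret : Tree → Odd → Odd
  zer : Even → Odd

data Even where
  dyck : Tree → Even
  up   : Odd → Tree → Even

oddWord  : Odd → List Bool
evenWord : Even → List Bool

oddWord (one u)   = true ∷ word u
oddWord (ret u t) = true ∷ word u ++ false ∷ oddWord t
oddWord (zer b)   = false ∷ evenWord b

evenWord (dyck u) = word u
evenWord (up t v) = oddWord t ++ true ∷ word v

-- The tree u with t on the path full u.
owner : Odd → Tree
owner (one u)          = u
owner (ret u t)        = node u (owner t)
owner (zer (dyck u))   = u
owner (zer (up t v))   = node (owner t) v

zup : Tree → Odd → Odd
zup v t = zer (up t v)

-- The path full u leads from 1u via 0u to u0; rest u is what follows 0u.
full rest : Tree → List Odd
full u = one u ∷ zer (dyck u) ∷ rest u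
rest leaf       = []
rest (node u v) = map (zup v) (full u) ++ map (ret u) (full v)

-- Together with `∈-full-owner` this makes the lists `full u` a partition of `Odd`.
∈full⇒owner : ∀ {t} u → t ∈ full u → owner t ≡ u
∈rest⇒owner : ∀ {t} u → t ∈ rest u → owner t ≡ u

∈full⇒owner u (here refl)         = refl
∈full⇒owner u (there (here refl)) = refl
∈full⇒owner u (there (there t∈))  = ∈rest⇒owner u t∈

∈rest⇒owner (node u v) t∈ with ∈-++⁻ (map (zup v) (full u)) t∈
... | inj₁ t∈ˡ with _ , s∈ , refl ← ∈-map⁻ (zup v) t∈ˡ = cong (λ w → node w v) (∈full⇒owner u s∈)
... | inj₂ t∈ʳ with _ , s∈ , refl ← ∈-map⁻ (ret u) t∈ʳ = cong (node u) (∈full⇒owner v s∈)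

∈-full-owner : ∀ t → t ∈ full (owner t)
∈-full-owner (one u)        = here refl
∈-full-owner (ret u t)      = there (there (∈-++⁺ʳ (map (zup (owner t)) (full u)) (∈-map⁺ (ret u) (∈-full-owner t))))
∈-full-owner (zer (dyck u)) = there (here refl)
∈-full-owner (zer (up t v)) = there (there (∈-++⁺ˡ (∈-map⁺ (zup v) (∈-full-owner t))))

one∉rest : ∀ {w} u → ¬ one w ∈ rest u
one∉rest (node u v) t∈ with ∈-++⁻ (map (zup v) (full u)) t∈
... | inj₁ t∈ˡ with _ , _ , () ← ∈-map⁻ (zup v) t∈ˡ
... | inj₂ t∈ʳ with _ , _ , () ← ∈-map⁻ (ret u) t∈ʳ

dyck∉rest : ∀ {w} u → ¬ zer (dyck w) ∈ rest u
dyck∉rest (node u v) t∈ with ∈-++⁻ (map (zup v) (full u)) t∈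
... | inj₁ t∈ˡ with _ , _ , () ← ∈-map⁻ (zup v) t∈ˡ
... | inj₂ t∈ʳ with _ , _ , () ← ∈-map⁻ (ret u) t∈ʳ

-- The tail may belong to another tree `w`, as it does after an exchange.
full-with-unique : ∀ {w ts} u → (∀ {t} → t ∈ ts → t ∈ rest w) → Unique ts →
                   Unique (one u ∷ zer (dyck u) ∷ ts)
full-with-unique {w} u ts⊆ uts =
  ((λ ()) ∷ All.tabulate λ { t∈ refl → one∉rest w (ts⊆ t∈) }) ∷
  All.tabulate (λ { t∈ refl → dyck∉rest w (ts⊆ t∈) }) ∷ uts

full-unique : ∀ u → Unique (full u)
rest-unique : ∀ u → Unique (rest u)

full-unique u = full-with-unique {u} u id (rest-unique u)

rest-unique leaf       = []
rest-unique (node u v) = Unique.++⁺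
  (Unique.map⁺ (λ { refl → refl }) (full-unique u))
  (Unique.map⁺ (λ { refl → refl }) (full-unique v))
  λ (t∈ˡ , t∈ʳ) → disjoint t∈ˡ t∈ʳ
  where
  disjoint : ∀ {t} → t ∈ map (zup v) (full u) → ¬ t ∈ map (ret u) (full v)
  disjoint t∈ˡ t∈ʳ with _ , _ , refl ← ∈-map⁻ (zup v) t∈ˡ with _ , _ , () ← ∈-map⁻ (ret u) t∈ʳ

-- Adjacency along the paths

data Differ : Rel (List Bool) 0ℓ where
  here  : ∀ {b c w} → b ≢ c → Differ (b ∷ w) (c ∷ w)
  there : ∀ {b v w} → Differ v w → Differ (b ∷ v) (b ∷ w)

differ-sym : Symmetric Differ
differ-sym (here b≢c) = here (≢-sym b≢c)
differ-sym (there d)  = there (differ-sym d)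

differ-++ˡ : ∀ u {v w} → Differ v w → Differ (u ++ v) (u ++ w)
differ-++ˡ []      d = d
differ-++ˡ (_ ∷ u) d = there (differ-++ˡ u d)

differ-++ʳ : ∀ {v w} u → Differ v w → Differ (v ++ u) (w ++ u)
differ-++ʳ u (here b≢c) = here b≢c
differ-++ʳ u (there d)  = there (differ-++ʳ u d)

0↔1 : ∀ {w} → Differ (false ∷ w) (true ∷ w)
0↔1 = here λ ()

infix 4 _~_
_~_ : Rel Odd 0ℓ
s ~ t = Differ (oddWord s) (oddWord t)

last : Tree → Odd
last leaf       = zer (dyck leaf)
last (node u v) = ret u (last v)

word-last : ∀ u → oddWord (last u) ≡ word u ++ false ∷ []
word-last leaf       = refl
word-last (node u v) = cong (true ∷_) (trans (cong (λ w → word u ++ false ∷ w) (word-last v))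
  (sym (++-assoc (word u) (false ∷ word v) (false ∷ []))))

-- The words 1u0v0 and 1u1v0 differ in the letter after u.
last~rotate : ∀ u → last u ~ one (rotate u)
last~rotate leaf       = 0↔1
last~rotate (node u v) rewrite word-last v | word-⊕ u (node v leaf) =
  there (differ-++ˡ (word u) 0↔1)

path-map : ∀ {X Y : Set} {R : Rel X 0ℓ} {Q : Rel Y 0ℓ} {a b xs} (f : X → Y) →
           (∀ {x y} → R x y → Q (f x) (f y)) → Path R a xs b → Path Q (f a) (map f xs) (f b)
path-map f h []      = []
path-map f h (r ∷ p) = h r ∷ path-map f h p

full-path : ∀ u → Path _~_ (one u) (zer (dyck u) ∷ rest u) (last u)
-- From 01u0v step to 01u1v, follow the path of u between 0 and 1v up to 0u01v, step to 1u01v, and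
-- follow the path of v behind 1u0 up to 1u0v0.
rest-path : ∀ u → Path _~_ (zer (dyck u)) (rest u) (last u)

full-path u = differ-sym 0↔1 ∷ rest-path u

rest-path leaf       = []
rest-path (node u v) = there (there (differ-++ˡ (word u) 0↔1)) ∷
  path-++ (path-map (zup v) (there ∘ differ-++ʳ (true ∷ word v)) (full-path u))
    (step ∷ path-map (ret u) (there ∘ differ-++ˡ (word u) ∘ there) (full-path v))
  where
  step : zup v (last u) ~ ret u (one v)
  step rewrite word-last u | ++-assoc (word u) (false ∷ []) (true ∷ word v) = 0↔1

-- Rerouting along 6-cycles

-- For x = 110u0v and y = 101u0v the 6-cycle
--   0110u0v 0110u1v 0100u1v 0101u1v 0101u0v 0111u0v
-- alternates between edges of the two paths and other edges. Exchanging them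
-- leads from 0x to y0 along rest y, and from 0y to x0 along rest x with its
-- first five vertices reversed.
rerouted : Tree → List Odd
rerouted (node (node leaf u) v) =
  zup v (ret leaf (one u)) ∷ zup v (zup u (zer (dyck leaf))) ∷ zup v (zup u (one leaf)) ∷
  zup v (zer (dyck (node leaf u))) ∷ zup v (one (node leaf u)) ∷
  zup v (ret leaf (zer (dyck u))) ∷ map (zup v) (map (ret leaf) (rest u)) ++
  map (ret (node leaf u)) (full v)
rerouted u = rest u

tails : Bool → Tree → List Odd
tails false = rest
tails true  = rerouted

-- Rerouting only reorders a tail, so the partition and the absence of repetitions survive it.
tails-↭ : ∀ b u → tails b u ↭ rest u
tails-↭ false u                              = ↭-refl
tails-↭ true  leaf                           = ↭-refl
tails-↭ true  (node leaf v)                  = ↭-refl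
tails-↭ true  (node (node leaf u) v)         = ++⁺ʳ _ (↭-reverse (_ ∷ _ ∷ _ ∷ _ ∷ _ ∷ []))
tails-↭ true  (node (node (node _ _) _) _)   = ↭-refl

tails-path : ∀ b u → Path _~_ (zer (dyck u)) (tails b (move b u)) (last (move b u))
tails-path false u = rest-path u
tails-path true leaf             = []
tails-path true (node leaf leaf) = rest-path (node leaf leaf)
tails-path true x@(node (node leaf u) v) with rest-path (flip x)
-- The edge from 0y to 0111u0v gives way to the edge from 0x to the same word.
... | _ ∷ p = there (there (there 0↔1)) ∷ p
tails-path true y@(node leaf (node u v)) with rest-path (flip y)
-- The two edges dropped are those that the 6-cycle shares with the path of x; the four between them
-- are run backwards.
... | _ ∷ e₁ ∷ e₂ ∷ e₃ ∷ e₄ ∷ _ ∷ p =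
  there (there (there (there (differ-++ˡ (word u) 0↔1)))) ∷
  differ-sym e₄ ∷ differ-sym e₃ ∷ differ-sym e₂ ∷ differ-sym e₁ ∷
  there (there (differ-sym 0↔1)) ∷ p
tails-path true t@(node (node (node _ _) _) _) = rest-path t

-- The paths after the chosen exchanges

module _ (S : Choice) where

  segment : Tree → List Odd
  segment u = one u ∷ zer (dyck u) ∷ tails (S (key u)) (swap S u)

  -- An exchange leaves the first two vertices of each path in place and hands the tail to the
  -- partner.
  segmentOwner : Odd → Tree
  segmentOwner (one u)        = u
  segmentOwner (zer (dyck u)) = u
  segmentOwner t              = swap S (owner t)

  ∈rest⇒segmentOwner : ∀ {t} u → t ∈ rest u → segmentOwner t ≡ swap S u
  ∈rest⇒segmentOwner {one _}        u t∈ = ⊥-elim (one∉rest u t∈)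
  ∈rest⇒segmentOwner {zer (dyck _)} u t∈ = ⊥-elim (dyck∉rest u t∈)
  ∈rest⇒segmentOwner {ret _ _}      u t∈ = cong (swap S) (∈rest⇒owner u t∈)
  ∈rest⇒segmentOwner {zer (up _ _)} u t∈ = cong (swap S) (∈rest⇒owner u t∈)

  ∈segment⇒segmentOwner : ∀ {t} u → t ∈ segment u → segmentOwner t ≡ u
  ∈segment⇒segmentOwner u (here refl)         = refl
  ∈segment⇒segmentOwner u (there (here refl)) = refl
  ∈segment⇒segmentOwner u (there (there t∈))  =
    trans (∈rest⇒segmentOwner (swap S u) (∈-resp-↭ (tails-↭ (S (key u)) _) t∈)) (swap-involutive S u)

  ∈rest⇒∈segment : ∀ {t} u → t ∈ rest u → t ∈ segment (swap S u)
  ∈rest⇒∈segment u t∈ = there (there (∈-resp-↭ (↭-sym (tails-↭ (S (key (swap S u))) _))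
    (subst (λ w → _ ∈ rest w) (sym (swap-involutive S u)) t∈)))

  ∈segment-segmentOwner : ∀ t → t ∈ segment (segmentOwner t)
  ∈segment-segmentOwner (one u)          = here refl
  ∈segment-segmentOwner (zer (dyck u))   = there (here refl)
  ∈segment-segmentOwner t@(ret _ _)      with ∈-full-owner t
  ... | there (there t∈) = ∈rest⇒∈segment (owner t) t∈
  ∈segment-segmentOwner t@(zer (up _ _)) with ∈-full-owner t
  ... | there (there t∈) = ∈rest⇒∈segment (owner t) t∈

  size-segmentOwner : ∀ t → size (segmentOwner t) ≡ size (owner t)
  size-segmentOwner (one u)          = refl
  size-segmentOwner (zer (dyck u))   = refl
  size-segmentOwner t@(ret _ _)      = size-move (S (key (owner t))) (owner t)
  size-segmentOwner t@(zer (up _ _)) = size-move (S (key (owner t))) (owner t)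

  segment-unique : ∀ u → Unique (segment u)
  segment-unique u = full-with-unique {swap S u} u (∈-resp-↭ (tails-↭ (S (key u)) _))
    (Unique-resp-↭ (setoid Odd) (↭⇒↭ₛ (↭-sym (tails-↭ (S (key u)) _))) (rest-unique (swap S u)))

  segments-unique : ∀ {us} → Unique us → Unique (concatMap segment us)
  segments-unique {[]}     []          = []
  segments-unique {u ∷ us} (u∉ ∷ uus) = Unique.++⁺ (segment-unique u) (segments-unique uus)
    λ (t∈u , t∈us) → disjoint t∈u (∈-concatMap⁻ segment {xs = us} t∈us) u∉
    where
    disjoint : ∀ {t vs} → t ∈ segment u → Any (λ v → t ∈ segment v) vs → ¬ All (u ≢_) vs
    disjoint t∈u (here t∈v) (u≢v ∷ _) =
      u≢v (trans (sym (∈segment⇒segmentOwner u t∈u)) (∈segment⇒segmentOwner _ t∈v))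
    disjoint t∈u (there t∈) (_ ∷ u∉) = disjoint t∈u t∈ u∉

  -- Consecutive segments are linked by `last~rotate`, since `succ S a` is the rotation of
  -- `swap S a`.
  segments-path : ∀ {a us b} → Path (Next (succ S)) a us b →
    ∃ λ ts → concatMap segment (a ∷ us) ≡ one a ∷ ts × Path _~_ (one a) ts (last (swap S b))
  segments-path {a} {[]} [] = _ , ++-identityʳ _ , differ-sym 0↔1 ∷ tails-path (S (key a)) a
  segments-path {a} (refl ∷ p) with ts , eq , q ← segments-path p =
    _ , cong (segment a ++_) eq ,
    path-++ (differ-sym 0↔1 ∷ tails-path (S (key a)) a) (last~rotate (swap S a) ∷ q)

-- Unique parsing of words

-- (d , [d₁,…,dₚ] , [eq,…,e₁]) stands for the word d0d₁…0dₚ1e₁…1eq,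
-- where all unmatched letters are displayed.
Parse : Set
Parse = Tree × List Tree × List Tree

downs : List Tree → List Bool → List Bool
downs []       w = w
downs (d ∷ ds) w = false ∷ word d ++ downs ds w

ups : List Tree → List Bool
ups []       = []
ups (e ∷ es) = ups es ++ true ∷ word e

unparse : Parse → List Bool
unparse (d , ds , es) = word d ++ downs ds (ups es)

-- A new 1 is matched with the first unmatched 0. If there is none, it is the leftmost unmatched 1,
-- hence last in the reversed list.
cons : Bool → Parse → Parse
cons false (d , ds     , es) = leaf , d ∷ ds , es
cons true  (d , c ∷ ds , es) = node d c , ds , es
cons true  (d , []     , es) = leaf , [] , es ∷ʳ d

parse : List Bool → Parse
parse = foldr cons (leaf , [] , [])

ups-∷ʳ : ∀ es d → ups (es ∷ʳ d) ≡ true ∷ word d ++ ups es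
ups-∷ʳ []       d = cong (true ∷_) (sym (++-identityʳ (word d)))
ups-∷ʳ (e ∷ es) d = trans (cong (_++ true ∷ word e) (ups-∷ʳ es d))
  (cong (true ∷_) (++-assoc (word d) (ups es) (true ∷ word e)))

unparse-cons : ∀ b p → unparse (cons b p) ≡ b ∷ unparse p
unparse-cons false (d , ds     , es) = refl
unparse-cons true  (d , c ∷ ds , es) =
  cong (true ∷_) (++-assoc (word d) (false ∷ word c) (downs ds (ups es)))
unparse-cons true  (d , []     , es) = ups-∷ʳ es d

unparse-parse : ∀ w → unparse (parse w) ≡ w
unparse-parse []      = refl
unparse-parse (b ∷ w) = trans (unparse-cons b (parse w)) (cong (b ∷_) (unparse-parse w))

parse-injective : ∀ {v w} → parse v ≡ parse w → v ≡ w
parse-injective {v} {w} eq = trans (sym (unparse-parse v)) (trans (cong unparse eq) (unparse-parse w))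

prefix : Tree → Parse → Parse
prefix u (d , ds , es) = u ⊕ d , ds , es

addUp : Tree → Parse → Parse
addUp v (d , ds , es) = d , ds , v ∷ es

parse-word-++ : ∀ u w → parse (word u ++ w) ≡ prefix u (parse w)
parse-word-++ leaf       w = refl
parse-word-++ (node a b) w = begin
  parse (word (node a b) ++ w)                              ≡⟨ cong (parse ∘ (true ∷_)) (++-assoc (word a) _ w) ⟩
  cons true (parse (word a ++ false ∷ word b ++ w))         ≡⟨ cong (cons true) (parse-word-++ a (false ∷ word b ++ w)) ⟩
  cons true (prefix a (cons false (parse (word b ++ w))))   ≡⟨ cong (λ p → cons true (prefix a (cons false p))) (parse-word-++ b w) ⟩
  cons true (prefix a (cons false (prefix b (parse w))))    ≡⟨ cong (λ u → node u _ , _) (⊕-identityʳ a) ⟩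
  prefix (node a b) (parse w)                               ∎
  where open ≡-Reasoning

parse-word : ∀ u → parse (word u) ≡ (u , [] , [])
parse-word u = trans (cong parse (sym (++-identityʳ (word u))))
  (trans (parse-word-++ u []) (cong (_, _) (⊕-identityʳ u)))

cons-addUp : ∀ b v p → cons b (addUp v p) ≡ addUp v (cons b p)
cons-addUp false v p                = refl
cons-addUp true  v (d , []    , es) = refl
cons-addUp true  v (d , _ ∷ _ , es) = refl

parse-up : ∀ w v → parse (w ++ true ∷ word v) ≡ addUp v (parse w)
parse-up []      v = cong (cons true) (parse-word v)
parse-up (b ∷ w) v = trans (cong (cons b) (parse-up w v)) (cons-addUp b v (parse w))

oddParse  : Odd → Parse
evenParse : Even → Parse

oddParse (one u)   = leaf , [] , u ∷ []
oddParse (ret u t) = let d , ds , es = oddParse t in node u d , ds , es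
oddParse (zer b)   = cons false (evenParse b)

evenParse (dyck u) = u , [] , []
evenParse (up t v) = addUp v (oddParse t)

parse-oddWord  : ∀ t → parse (oddWord t) ≡ oddParse t
parse-evenWord : ∀ b → parse (evenWord b) ≡ evenParse b

parse-oddWord (one u)   = cong (cons true) (parse-word u)
parse-oddWord (ret u t) = begin
  cons true (parse (word u ++ false ∷ oddWord t))     ≡⟨ cong (cons true) (parse-word-++ u (false ∷ oddWord t)) ⟩
  cons true (prefix u (cons false (parse (oddWord t)))) ≡⟨ cong (λ p → cons true (prefix u (cons false p))) (parse-oddWord t) ⟩
  cons true (prefix u (cons false (oddParse t)))      ≡⟨ cong (λ u → node u _ , _) (⊕-identityʳ u) ⟩
  oddParse (ret u t)                                  ∎
  where open ≡-Reasoning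
parse-oddWord (zer b)   = cong (cons false) (parse-evenWord b)

parse-evenWord (dyck u) = parse-word u
parse-evenWord (up t v) = trans (parse-up (oddWord t) v) (cong (addUp v) (parse-oddWord t))

-- The shape of the parse reveals the constructor: `ret` if the first tree is a node, otherwise
-- `zer` or `one` according to whether there is an unmatched 0; `up` or `dyck` according to whether
-- there is an unmatched 1.
oddParse-injective  : ∀ s t → oddParse s ≡ oddParse t → s ≡ t
evenParse-injective : ∀ a b → evenParse a ≡ evenParse b → a ≡ b

oddParse-injective (one u)   (one v)   refl = refl
oddParse-injective (ret u s) (ret v t) eq
  with refl ← cong ((λ { (node u _) → u ; leaf → leaf }) ∘ proj₁) eq =
  cong (ret u) (oddParse-injective s t (cong (λ { (node _ d , p) → d , p ; p → p }) eq))
oddParse-injective (zer a)   (zer b)   eq   =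
  cong zer (evenParse-injective a b (cong (λ { (_ , d ∷ ds , es) → d , ds , es ; p → p }) eq))

evenParse-injective (dyck u) (dyck v) refl = refl
evenParse-injective (up s u) (up t v) eq
  with refl ← cong (λ { (_ , _ , e ∷ _) → e ; _ → leaf }) eq =
  cong (λ t → up t u) (oddParse-injective s t (cong (λ { (d , ds , _ ∷ es) → d , ds , es ; p → p }) eq))

oddWord-injective : ∀ {s t} → oddWord s ≡ oddWord t → s ≡ t
oddWord-injective {s} {t} eq = oddParse-injective s t
  (trans (sym (parse-oddWord s)) (trans (cong parse eq) (parse-oddWord t)))

-- The excess of 1s over 0s is -1 or 1 here and 0 or 2 for `Even`; removing an unmatched 0 or a last
-- unmatched 1 passes from one case to the other.
oddParse-onto : ∀ d ds es → length ds ≡ suc (length es) ⊎ length es ≡ suc (length ds) →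
                ∃ λ t → oddParse t ≡ (d , ds , es)
evenParse-onto : ∀ d ds es → length ds ≡ length es ⊎ length es ≡ 2 + length ds →
                 ∃ λ b → evenParse b ≡ (d , ds , es)

oddParse-onto (node u d) ds es bal =
  let t , eq = oddParse-onto d ds es bal
  in  ret u t , cong (λ (d , p) → node u d , p) eq
oddParse-onto leaf (d ∷ ds) es bal =
  let b , eq = evenParse-onto d ds es (Sum.map₁ suc-injective bal)
  in  zer b , cong (cons false) eq
oddParse-onto leaf [] (e ∷ [])    _         = one e , refl
oddParse-onto leaf [] (_ ∷ _ ∷ _) (inj₁ ())
oddParse-onto leaf [] (_ ∷ _ ∷ _) (inj₂ ())
oddParse-onto leaf [] []          (inj₁ ())
oddParse-onto leaf [] []          (inj₂ ())

evenParse-onto d ds (e ∷ es) bal =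
  let t , eq = oddParse-onto d ds es (Sum.map₂ suc-injective bal)
  in  up t e , cong (addUp e) eq
evenParse-onto d []       [] _         = dyck d , refl
evenParse-onto d (_ ∷ _) [] (inj₁ ())
evenParse-onto d (_ ∷ _) [] (inj₂ ())

-- Counting letters

count₁ : List Bool → ℕ
count₁ []          = 0
count₁ (true ∷ w)  = suc (count₁ w)
count₁ (false ∷ w) = count₁ w

ones-toList : ∀ {n} (v : Vec Bool n) → ones v ≡ count₁ (toList v)
ones-toList []          = refl
ones-toList (true ∷ v)  = cong suc (ones-toList v)
ones-toList (false ∷ v) = ones-toList v

count₁-++ : ∀ v w → count₁ (v ++ w) ≡ count₁ v + count₁ w
count₁-++ []          w = refl
count₁-++ (true ∷ v)  w = cong suc (count₁-++ v w)
count₁-++ (false ∷ v) w = count₁-++ v w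

-- The excess of 1s over 0s is that of the unmatched letters, written without subtraction.
Balanced : List Bool → Parse → Set
Balanced w (_ , ds , es) = 2 * count₁ w + length ds ≡ length w + length es

cons-balance : ∀ b w p → Balanced w p → Balanced (b ∷ w) (cons b p)
cons-balance false w (d , ds , es) eq = trans (+-suc (2 * count₁ w) (length ds)) (cong suc eq)
cons-balance true  w (d , c ∷ ds , es) eq = trans (shift (count₁ w) (length ds)) (cong suc eq)
  where
  shift : ∀ m n → 2 * suc m + n ≡ suc (2 * m + suc n)
  shift = solve-∀
cons-balance true  w (d , [] , es) eq = begin
  2 * suc (count₁ w) + 0              ≡⟨ shift (count₁ w) ⟩
  2 + (2 * count₁ w + 0)              ≡⟨ cong (2 +_) eq ⟩
  2 + (length w + length es)          ≡⟨ cong suc (+-suc (length w) (length es)) ⟨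
  suc (length w + suc (length es))    ≡⟨ cong (λ n → suc (length w + n)) (trans (length-++ es) (+-comm (length es) 1)) ⟨
  suc (length w + length (es ∷ʳ d))   ∎
  where
  open ≡-Reasoning
  shift : ∀ m → 2 * suc m + 0 ≡ 2 + (2 * m + 0)
  shift = solve-∀

parse-balance : ∀ w → Balanced w (parse w)
parse-balance []      = refl
parse-balance (b ∷ w) = cons-balance b w (parse w) (parse-balance w)

length-word : ∀ u → length (word u) ≡ 2 * size u
length-word leaf       = refl
length-word (node u v) rewrite length-++ (word u) {false ∷ word v} | length-word u | length-word v =
  arith (size u) (size v)
  where
  arith : ∀ m n → suc (2 * m + suc (2 * n)) ≡ 2 * suc (m + n)
  arith = solve-∀

private
  length-ret : ∀ m n → 1 + (2 * m + (2 + 2 * n)) ≡ 1 + 2 * (1 + (m + n))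
  length-ret = solve-∀

  length-up : ∀ m n → 1 + (1 + 2 * m + (1 + 2 * n)) ≡ 1 + 2 * (1 + (m + n))
  length-up = solve-∀

length-oddWord : ∀ t → length (oddWord t) ≡ suc (2 * size (owner t))
length-oddWord (one u)        = cong suc (length-word u)
length-oddWord (zer (dyck u)) = cong suc (length-word u)
length-oddWord (ret u t)
  rewrite length-++ (word u) {false ∷ oddWord t} | length-word u | length-oddWord t =
  length-ret (size u) (size (owner t))
length-oddWord (zer (up t v))
  rewrite length-++ (oddWord t) {true ∷ word v} | length-word v | length-oddWord t =
  length-up (size (owner t)) (size v)

count₁-word : ∀ u → count₁ (word u) ≡ size u
count₁-word leaf       = refl
count₁-word (node u v) = cong suc (trans (count₁-++ (word u) (false ∷ word v))
  (cong₂ _+_ (count₁-word u) (count₁-word v)))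

count₁-oddWord : ∀ t → count₁ (oddWord t) ≡ size (owner t) ⊎ count₁ (oddWord t) ≡ suc (size (owner t))
count₁-oddWord (one u)        = inj₂ (cong suc (count₁-word u))
count₁-oddWord (zer (dyck u)) = inj₁ (count₁-word u)
count₁-oddWord (ret u t)
  rewrite count₁-++ (word u) (false ∷ oddWord t) | count₁-word u =
  Sum.map (λ eq → cong (λ n → suc (size u + n)) eq)
          (λ eq → cong suc (trans (cong (size u +_) eq) (+-suc (size u) _))) (count₁-oddWord t)
count₁-oddWord (zer (up t v))
  rewrite count₁-++ (oddWord t) (true ∷ word v) | count₁-word v | +-suc (count₁ (oddWord t)) (size v) =
  Sum.map (cong (λ n → suc (n + size v))) (cong (λ n → suc (n + size v))) (count₁-oddWord t)

-- By `parse-balance` the numbers of unmatched 0s and 1s differ by one, so `oddParse-onto` applies;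
-- the length then gives the size of the owner.
oddWord-onto : ∀ k w → length w ≡ 2 * k + 1 → count₁ w ≡ k ⊎ count₁ w ≡ k + 1 →
               ∃ λ t → oddWord t ≡ w × size (owner t) ≡ k
oddWord-onto k w |w| ones-w =
  let d , ds , es = parse w
      t , eq      = oddParse-onto d ds es (balanced ones-w (parse-balance w))
      tw          = parse-injective (trans (parse-oddWord t) eq)
  in  t , tw , *-cancelˡ-≡ _ _ 2 (suc-injective
        (trans (sym (length-oddWord t)) (trans (cong length tw) (trans |w| (+-comm (2 * k) 1)))))
  where
  balanced : ∀ {m n} → count₁ w ≡ k ⊎ count₁ w ≡ k + 1 → 2 * count₁ w + m ≡ length w + n →
             m ≡ suc n ⊎ n ≡ suc m
  balanced {m} {n} (inj₁ c) eq rewrite c | |w| =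
    inj₁ (+-cancelˡ-≡ (2 * k) _ _ (trans eq (+-assoc (2 * k) 1 n)))
  balanced {m} {n} (inj₂ c) eq rewrite c | |w| =
    inj₂ (sym (+-cancelˡ-≡ (2 * k + 1) _ _ (trans (arith k m) eq)))
    where
    arith : ∀ k m → (2 * k + 1) + suc m ≡ 2 * (k + 1) + m
    arith = solve-∀

-- From words to vertices of the graph

differ⇒adj : ∀ {n} (u v : Vec Bool n) → Differ (toList u) (toList v) → Graph.Adj (Hypercube n) u v
differ⇒adj (b ∷ u) (c ∷ v) d = go u v d refl refl
  where
  -- The lists become variables tied by equations, so that `Differ` can be matched on.
  go : ∀ {n b c us vs} (u v : Vec Bool n) → Differ (b ∷ us) (c ∷ vs) → us ≡ toList u → vs ≡ toList v →
       Graph.Adj (Hypercube (suc n)) (b ∷ u) (c ∷ v)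
  go u v (here b≢c) refl eq = zero , b≢c , λ
    { {zero} _ → refl
    ; {suc i} ne → ⊥-elim (ne (cong (λ w → lookup w i)
        (trans (sym (Vec.cast-is-id refl u)) (Vec.toList-injective refl u v eq)))) }
  go u v (there d) refl refl with i , ne , unique ← differ⇒adj u v d = suc i , ne , λ
    { {zero} b≢b → ⊥-elim (b≢b refl)
    ; {suc j} ne′ → cong suc (unique ne′) }

closeUp-map : ∀ {X Y : Set} (f : X → Y) xs → closeUp (map f xs) ≡ map f (closeUp xs)
closeUp-map f []       = refl
closeUp-map f (x ∷ xs) = cong (f x ∷_) (sym (map-++ f xs (x ∷ [])))

path-linked : ∀ {X : Set} {R : Rel X 0ℓ} {a b c xs} → Path R a xs b → R b c → Linked R (a ∷ xs ∷ʳ c)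
path-linked []          r = r ∷ [-]
path-linked (r′ ∷ [])   r = r′ ∷ r ∷ [-]
path-linked (r′ ∷ p@(_ ∷ _)) r = r′ ∷ path-linked p r

module _ (k : ℕ) where

  open Graph (MiddleLevels k) using (Vertex; Adj)

  letters : Vertex → List Bool
  letters = toList ∘ value

  letters-injective : ∀ {u v} → letters u ≡ letters v → u ≡ v
  letters-injective {u ⊢ _} {v ⊢ _} eq
    with refl ← trans (sym (Vec.cast-is-id refl u)) (Vec.toList-injective refl u v eq) = refl

  Middle : List Bool → Set
  Middle w = length w ≡ 2 * k + 1 × (count₁ w ≡ k ⊎ count₁ w ≡ k + 1)

  vertex : ∀ {w} → Middle w → ∃ λ v → letters v ≡ w
  vertex {w} (|w| , c) = (v ⊢ irr (Sum.map (trans ones-v) (trans ones-v) c)) , v≡w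
    where
    v : Vec Bool (2 * k + 1)
    v = Vec.cast |w| (fromList w)
    v≡w : toList v ≡ w
    v≡w = trans (Vec.toList-cast |w| (fromList w)) (Vec.toList∘fromList w)
    ones-v : ones v ≡ count₁ w
    ones-v = trans (ones-toList v) (cong count₁ v≡w)

  vertices : ∀ {ws} → All Middle ws → ∃ λ vs → map letters vs ≡ ws
  vertices []       = [] , refl
  vertices (m ∷ ms) =
    let v , eq = vertex m ; vs , eqs = vertices ms in v ∷ vs , cong₂ _∷_ eq eqs

  middle : ∀ v → Middle (letters v)
  middle (v ⊢ irr level) = Vec.length-toList v ,
    Sum.map (trans (sym (ones-toList v))) (trans (sym (ones-toList v)))
      -- The level proof is irrelevant; a usable one is recovered by deciding the condition.
      (recompute ((ones v ℕ.≟ k) ⊎-dec (ones v ℕ.≟ k + 1)) level)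

  cycleFromWords : ∀ {ws} → 3 ≤ length ws → All Middle ws → Unique ws → Linked Differ (closeUp ws) →
                   (∀ {w} → Middle w → w ∈ ws) → HasHamiltonianCycle (MiddleLevels k)
  cycleFromWords long mid uniq link complete with vertices mid
  ... | vs , refl = vs , record
    { length≥3 = subst (3 ≤_) (length-map letters vs) long
    ; distinct = Unique.map⁻ uniq
    ; adjacent = Linked.map (λ {u} {v} → differ⇒adj (value u) (value v))
        (Linked.map⁻ (subst (Linked Differ) (closeUp-map letters vs) link))
    } , covered
    where
    covered : ∀ v → v ∈ vs
    covered v with u , u∈ , eq ← ∈-map⁻ letters (complete (middle v)) =
      subst (_∈ vs) (sym (letters-injective eq)) u∈

-- Assembling the Hamiltonian cycle

segment-length : ∀ S u ts {k} → size u ≡ suc k → 3 ≤ length (segment S u ++ ts)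
segment-length S u ts |u| = nonempty (tails-path (S (key u)) u) (trans (size-move (S (key u)) u) |u|)
  where
  -- An empty tail would make 0u the word v0, but v is nonempty and begins with 1.
  nonempty : ∀ {xs v k} → Path _~_ (zer (dyck u)) xs (last v) → size v ≡ suc k →
             3 ≤ length (one u ∷ zer (dyck u) ∷ xs ++ ts)
  nonempty {_ ∷ _} _ _ = s≤s (s≤s (s≤s z≤n))
  nonempty {[]} {node _ _} ()
  nonempty {[]} {leaf} _ ()

middleLevels : ∀ k → HasHamiltonianCycle (MiddleLevels (suc k))
middleLevels k = cycleFromWords (suc k)
  (subst (3 ≤_) (sym (length-map oddWord cycle)) (segment-length choice _ _ (sized (here refl))))
  (All.tabulate λ w∈ → middleWord (∈-map⁻ oddWord w∈))
  (Unique.map⁺ oddWord-injective (segments-unique choice unique))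
  linked
  covered
  where
  open SingleCycle (singleCycle (suc k))

  cycle : List Odd
  cycle = concatMap (segment choice) (succ choice start ∷ others)

  sizes : ∀ {t} → t ∈ cycle → size (owner t) ≡ suc k
  sizes {t} t∈ with u , u∈ , t∈u ← find (∈-concatMap⁻ (segment choice) {xs = succ choice start ∷ others} t∈) =
    trans (sym (size-segmentOwner choice t))
      (trans (cong size (∈segment⇒segmentOwner choice u t∈u)) (sized u∈))

  middleWord : ∀ {w} → (∃ λ t → t ∈ cycle × w ≡ oddWord t) → Middle (suc k) w
  middleWord (t , t∈ , refl) with |t| ← sizes t∈ =
    trans (length-oddWord t) (trans (cong (λ n → suc (2 * n)) |t|) (+-comm 1 _)) ,
    Sum.map (λ c → trans c |t|) (λ c → trans c (trans (cong suc |t|) (+-comm 1 _))) (count₁-oddWord t)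

  linked : Linked Differ (closeUp (map oddWord cycle))
  linked with ts , eq , p ← segments-path choice path =
    subst (Linked Differ) (sym (closeUp-map oddWord cycle))
      (Linked.map⁺ (subst (λ c → Linked _~_ (closeUp c)) (sym eq)
        -- The path ends with the segment of `start`, so its last vertex is adjacent to the first
        -- one, `one (succ choice start)`.
        (path-linked p (last~rotate (swap choice start)))))

  covered : ∀ {w} → Middle (suc k) w → w ∈ map oddWord cycle
  covered {w} (|w| , ones-w) with t , refl , |t| ← oddWord-onto (suc k) w |w| ones-w =
    ∈-map⁺ oddWord (∈-concatMap⁺ (segment choice)
      (lose (complete (segmentOwner choice t) (trans (size-segmentOwner choice t) |t|))
            (∈segment-segmentOwner choice t)))

mainTheorem1 : HasHamiltonianCycle (MiddleLevels 18)
mainTheorem1 = middleLevels 17
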